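{- Let $C\subseteq\{H,R,L,Fa\}$. Then the sequent calculus $\mathbf{STL}(N,D,C)$ has deductive interpolation. That is, for every set of sequents $\mathcal{S}$ and sequent $S$ with $\mathcal{S}\vdash_{\mathbf{STL}(N,D,C)}S$, there is a set of sequents $\mathcal{T}$ such that: - $V(\mathcal{T})\subseteq V(\mathcal{S})\cap V(S)$; - $\mathcal{T}\vdash_{\mathbf{STL}(N,D,C)}S$; - $\mathcal{S}\vdash_{\mathbf{STL}(N,D,C)}T$ for every $T\in\mathcal{T}$.
   Context: Language $\{\wedge,\vee,\to,\top,\bot,\nabla\}$, extended by $\supset$ when $H\in C$. A sequent is $\Gamma\Rightarrow\Delta$ with $\Gamma,\Delta$ finite multisets of formulas and $|\Delta|\le1$; $\nabla\Gamma=\{\nabla\gamma\mid\gamma\in\Gamma\}$. $V(\mathcal{S})$ is the set of propositional atoms occurring in the sequents of $\mathcal{S}$. $\mathbf{STL}$ rules (premises / conclusion): - Axioms: $A\Rightarrow A$; $\bot\Rightarrow$; $\Rightarrow\top$. - Weakening: $\Gamma\Rightarrow\Delta$ / $\Gamma,A\Rightarrow\Delta$; $\Gamma\Rightarrow$ / $\Gamma\Rightarrow A$. - Contraction: $\Gamma,A,A\Rightarrow\Delta$ / $\Gamma,A\Rightarrow\Delta$. - Cut: $\Gamma\Rightarrow A$, $\Pi,A\Rightarrow\Delta$ / $\Pi,\Gamma\Rightarrow\Delta$. - Conjunction: $\Gamma,A\Rightarrow\Delta$ / $\Gamma,A\wedge B\Rightarrow\Delta$ and likewise for $B$; $\Gamma\Rightarrow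 A$, $\Gamma\Rightarrow B$ / $\Gamma\Rightarrow A\wedge B$. - Disjunction: $A\Rightarrow\Delta$, $B\Rightarrow\Delta$ / $A\vee B\Rightarrow\Delta$; $\Gamma\Rightarrow A$ / $\Gamma\Rightarrow A\vee B$ and likewise for $B$. - Modality: $A\Rightarrow B$ / $\nabla A\Rightarrow\nabla B$. - Left implication: $\Gamma\Rightarrow A$, $\Gamma,B\Rightarrow\Delta$ / $\Gamma,\nabla(A\to B)\Rightarrow\Delta$. - Right implication: $\nabla\Gamma,A\Rightarrow B$ / $\Gamma\Rightarrow A\to B$. Additional rules: - (N): $\Gamma\Rightarrow\Delta$ / $\nabla\Gamma\Rightarrow\nabla\Delta$. - (D): $\Gamma,A\Rightarrow\Delta$, $\Gamma,B\Rightarrow\Delta$ / $\Gamma,A\vee B\Rightarrow\Delta$. - (R): $\Gamma\Rightarrow A$ / $\Gamma\Rightarrow\nabla A$. - (L): $\Gamma,A\Rightarrow\Delta$ / $\Gamma,\nabla A\Rightarrow\Delta$. - (Fa): $\Gamma,A\Rightarrow B$ / $\Gamma\Rightarrow\nabla(A\to B)$. - (H): the rules $\Gamma\Rightarrow A$, $\Gamma,B\Rightarrow\Delta$ / $\Gamma,A\supset B\Rightarrow\Delta$ and $\Gamma,A\Rightarrow B$ / $\Gamma\Rightarrow A\supset B$. $\mathbf{STL}(N,D,C)$ is $\mathbf{STL}$ plus these rules. $\mathcal{S}\vdash_G S$ means $S$ is derivable from premises $\mathcal{S}$ using rule instances of $G$. -}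

module Defs where

open import Data.Nat using (ℕ)
open import Data.Bool using (Bool; true; false; T)
open import Data.List using (List; []; _∷_; _++_; map)
open import Data.List.Relation.Unary.Any using (Any)
open import Data.List.Relation.Binary.Permutation.Propositional using (_↭_)
open import Data.Maybe using (Maybe; just; nothing)
open import Data.Product using (Σ; _×_; ∃)
open import Data.Sum using (_⊎_)
open import Relation.Binary.PropositionalEquality using (_≡_)

record Choice : Set where
  field
    H  : Bool
    R  : Bool
    L  : Bool
    Fa : Bool
open Choice public

-- Formulas over atoms ℕ.  The index h says whether the connective ⊃ is
-- part of the language (it is exactly when H ∈ C).
data Fm : Bool → Set where
  atom : ∀ {h} → ℕ → Fm h
  _∧_  : ∀ {h} → Fm h → Fm h → Fm h
  _∨_  : ∀ {h} → Fm h → Fm h → Fm h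
  _⇾_  : ∀ {h} → Fm h → Fm h → Fm h
  ⊤'   : ∀ {h} → Fm h
  ⊥'   : ∀ {h} → Fm h
  ∇    : ∀ {h} → Fm h → Fm h
  ⊃    : ∀ {h} {_ : T h} → Fm h → Fm h → Fm h

-- Sequents Γ ⇒ Δ with |Δ| ≤ 1.  Γ is a list read as a multiset
-- (an exchange rule below makes order irrelevant).
record Sequent (h : Bool) : Set where
  constructor _⇒_
  field
    ant : List (Fm h)
    suc : Maybe (Fm h)

∇s : ∀ {h} → List (Fm h) → List (Fm h)
∇s = map ∇

∇m : ∀ {h} → Maybe (Fm h) → Maybe (Fm h)
∇m nothing  = nothing
∇m (just A) = just (∇ A)

Lang : Choice → Bool
Lang C = H C

SeqC : Choice → Set
SeqC C = Sequent (Lang C)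

SeqSet : Choice → Set₁
SeqSet C = SeqC C → Set

data Deriv (C : Choice) (𝒮 : SeqSet C) : SeqC C → Set where
  hyp   : ∀ {S} → 𝒮 S → Deriv C 𝒮 S
  -- multiset reading of the antecedent
  exch  : ∀ {Γ Γ' Δ} → Γ ↭ Γ' → Deriv C 𝒮 (Γ ⇒ Δ) → Deriv C 𝒮 (Γ' ⇒ Δ)
  ax    : ∀ {A} → Deriv C 𝒮 ((A ∷ []) ⇒ just A)
  ax⊥   : Deriv C 𝒮 ((⊥' ∷ []) ⇒ nothing)
  ax⊤   : Deriv C 𝒮 ([] ⇒ just ⊤')
  wL    : ∀ {Γ Δ A} → Deriv C 𝒮 (Γ ⇒ Δ) → Deriv C 𝒮 ((A ∷ Γ) ⇒ Δ)
  wR    : ∀ {Γ A} → Deriv C 𝒮 (Γ ⇒ nothing) → Deriv C 𝒮 (Γ ⇒ just A)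
  cL    : ∀ {Γ Δ A} → Deriv C 𝒮 ((A ∷ A ∷ Γ) ⇒ Δ) → Deriv C 𝒮 ((A ∷ Γ) ⇒ Δ)
  cut   : ∀ {Γ Π Δ A} → Deriv C 𝒮 (Γ ⇒ just A) → Deriv C 𝒮 ((A ∷ Π) ⇒ Δ)
          → Deriv C 𝒮 ((Π ++ Γ) ⇒ Δ)
  ∧L₁   : ∀ {Γ Δ A B} → Deriv C 𝒮 ((A ∷ Γ) ⇒ Δ) → Deriv C 𝒮 (((A ∧ B) ∷ Γ) ⇒ Δ)
  ∧L₂   : ∀ {Γ Δ A B} → Deriv C 𝒮 ((B ∷ Γ) ⇒ Δ) → Deriv C 𝒮 (((A ∧ B) ∷ Γ) ⇒ Δ)
  ∧R    : ∀ {Γ A B} → Deriv C 𝒮 (Γ ⇒ just A) → Deriv C 𝒮 (Γ ⇒ just B)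
          → Deriv C 𝒮 (Γ ⇒ just (A ∧ B))
  ∨L    : ∀ {Δ A B} → Deriv C 𝒮 ((A ∷ []) ⇒ Δ) → Deriv C 𝒮 ((B ∷ []) ⇒ Δ)
          → Deriv C 𝒮 (((A ∨ B) ∷ []) ⇒ Δ)
  ∨R₁   : ∀ {Γ A B} → Deriv C 𝒮 (Γ ⇒ just A) → Deriv C 𝒮 (Γ ⇒ just (A ∨ B))
  ∨R₂   : ∀ {Γ A B} → Deriv C 𝒮 (Γ ⇒ just B) → Deriv C 𝒮 (Γ ⇒ just (A ∨ B))
  mod   : ∀ {A B} → Deriv C 𝒮 ((A ∷ []) ⇒ just B)
          → Deriv C 𝒮 ((∇ A ∷ []) ⇒ just (∇ B))
  ⇾L    : ∀ {Γ Δ A B} → Deriv C 𝒮 (Γ ⇒ just A) → Deriv C 𝒮 ((B ∷ Γ) ⇒ Δ)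
          → Deriv C 𝒮 ((∇ (A ⇾ B) ∷ Γ) ⇒ Δ)
  ⇾R    : ∀ {Γ A B} → Deriv C 𝒮 ((A ∷ ∇s Γ) ⇒ just B)
          → Deriv C 𝒮 (Γ ⇒ just (A ⇾ B))
  ruleN : ∀ {Γ Δ} → Deriv C 𝒮 (Γ ⇒ Δ) → Deriv C 𝒮 (∇s Γ ⇒ ∇m Δ)
  ruleD : ∀ {Γ Δ A B} → Deriv C 𝒮 ((A ∷ Γ) ⇒ Δ) → Deriv C 𝒮 ((B ∷ Γ) ⇒ Δ)
          → Deriv C 𝒮 (((A ∨ B) ∷ Γ) ⇒ Δ)
  ruleR  : ∀ {Γ A} → R C ≡ true → Deriv C 𝒮 (Γ ⇒ just A) → Deriv C 𝒮 (Γ ⇒ just (∇ A))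
  ruleL  : ∀ {Γ Δ A} → L C ≡ true → Deriv C 𝒮 ((A ∷ Γ) ⇒ Δ) → Deriv C 𝒮 ((∇ A ∷ Γ) ⇒ Δ)
  ruleFa : ∀ {Γ A B} → Fa C ≡ true → Deriv C 𝒮 ((A ∷ Γ) ⇒ just B)
           → Deriv C 𝒮 (Γ ⇒ just (∇ (A ⇾ B)))
  ⊃L : ∀ {Γ Δ A B} (t : T (H C))
       → Deriv C 𝒮 (Γ ⇒ just A) → Deriv C 𝒮 ((B ∷ Γ) ⇒ Δ)
       → Deriv C 𝒮 ((⊃ {_} {t} A B ∷ Γ) ⇒ Δ)
  ⊃R : ∀ {Γ A B} (t : T (H C))
       → Deriv C 𝒮 ((A ∷ Γ) ⇒ just B)
       → Deriv C 𝒮 (Γ ⇒ just (⊃ {_} {t} A B))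

data OccF {h} (p : ℕ) : Fm h → Set where
  here  : OccF p (atom p)
  ∧ˡ    : ∀ {A B} → OccF p A → OccF p (A ∧ B)
  ∧ʳ    : ∀ {A B} → OccF p B → OccF p (A ∧ B)
  ∨ˡ    : ∀ {A B} → OccF p A → OccF p (A ∨ B)
  ∨ʳ    : ∀ {A B} → OccF p B → OccF p (A ∨ B)
  ⇾ˡ    : ∀ {A B} → OccF p A → OccF p (A ⇾ B)
  ⇾ʳ    : ∀ {A B} → OccF p B → OccF p (A ⇾ B)
  ∇ᶠ    : ∀ {A} → OccF p A → OccF p (∇ A)
  ⊃ˡ    : ∀ {t A B} → OccF p A → OccF p (⊃ {_} {t} A B)
  ⊃ʳ    : ∀ {t A B} → OccF p B → OccF p (⊃ {_} {t} A B)

data OccM {h} (p : ℕ) : Maybe (Fm h) → Set where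
  just : ∀ {A} → OccF p A → OccM p (just A)

OccS : ∀ {h} → ℕ → Sequent h → Set
OccS p (Γ ⇒ Δ) = Any (OccF p) Γ ⊎ OccM p Δ

V : ∀ {h} → (Sequent h → Set) → ℕ → Set
V 𝒮 p = ∃ λ S → 𝒮 S × OccS p S

DeductiveInterpolation : Choice → Set₁
DeductiveInterpolation C =
  (𝒮 : SeqSet C) (S : SeqC C) → Deriv C 𝒮 S →
  Σ (SeqSet C) λ 𝒯 →
      (∀ p → V 𝒯 p → V 𝒮 p × OccS p S)
    × Deriv C 𝒯 S
    × (∀ T → 𝒯 T → Deriv C 𝒮 T)

{-# OPTIONS --safe #-}
-- Let 𝒯 be the set of all consequences of 𝒮 in the shared variables.  The
-- Lindenbaum algebras B of 𝒮 and C of 𝒯 share the sublattice A of formulas in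
-- the shared variables; form the pushout of B and C over A as distributive
-- lattices.  The ideals of the pushout are a model of the calculus: ∇ extends to ideals as a
-- lattice homomorphism preserving all joins, hence has a residual, and (R), (L)
-- and (Fa) (the latter says that ∇ is onto) are inherited.  The maps of B and C
-- into this model commute with → because an inequality ∇ c ∧ x ≤ y between the
-- two sides, with x and y in A, can be replaced by c ≤ x → y, which is again in
-- A; the same works for ⊃.  So S, being a consequence of 𝒮, holds in the model,
-- and C embeds into the pushout, so 𝒯 proves S.
module Submission where

open import Defs
open import Data.Bool using (Bool; true; false; T; _≟_)
open import Data.Bool.Properties using (¬-not)
open import Data.Empty using (⊥; ⊥-elim)
open import Data.List using (List; []; _∷_; _++_)
open import Data.List.Relation.Binary.Permutation.Propositional using (_↭_; ↭-refl; ↭-sym; prep; swap; trans)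
open import Data.List.Relation.Binary.Permutation.Propositional.Properties using (∷↭∷ʳ; All-resp-↭)
open import Data.List.Relation.Unary.All as All using (All; []; _∷_)
open import Data.List.Relation.Unary.All.Properties using (++⁻; map⁺)
open import Data.List.Relation.Unary.Any using (Any; here; there)
open import Data.Maybe using (Maybe; just; nothing)
open import Data.Nat using (ℕ)
open import Data.Product using (∃; _×_; _,_; proj₂)
open import Data.Sum using (_⊎_; inj₁; inj₂)
open import Data.Unit using (⊤; tt)
open import Function using (_∘_; id)
open import Relation.Binary.PropositionalEquality using (_≡_; refl; subst; sym; _≢_) renaming (trans to ≡-trans)
open import Relation.Nullary using (yes; no)

-- Derived rules, and sequents read as inequalities

module Calculus (C : Choice) where

  F : Set
  F = Fm (H C)

  infix 4 _⊢_≤_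
  infixr 5 _⨾_

  _⊢_≤_ : SeqSet C → F → F → Set
  𝒰 ⊢ A ≤ B = Deriv C 𝒰 ((A ∷ []) ⇒ just B)

  private variable
    𝒰 : SeqSet C
    A B D E : F
    Γ : List F
    Δ : Maybe F

  _⨾_ : 𝒰 ⊢ A ≤ B → 𝒰 ⊢ B ≤ D → 𝒰 ⊢ A ≤ D
  _⨾_ = cut

  ⟨_,_⟩ : 𝒰 ⊢ D ≤ A → 𝒰 ⊢ D ≤ B → 𝒰 ⊢ D ≤ (A ∧ B)
  ⟨_,_⟩ = ∧R

  π₁ : 𝒰 ⊢ (A ∧ B) ≤ A
  π₁ = ∧L₁ ax

  π₂ : 𝒰 ⊢ (A ∧ B) ≤ B
  π₂ = ∧L₂ ax

  ι₁ : 𝒰 ⊢ A ≤ (A ∨ B)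
  ι₁ = ∨R₁ ax

  ι₂ : 𝒰 ⊢ B ≤ (A ∨ B)
  ι₂ = ∨R₂ ax

  ⊤-max : 𝒰 ⊢ A ≤ ⊤'
  ⊤-max = wL ax⊤

  ⊥-min : 𝒰 ⊢ ⊥' ≤ A
  ⊥-min = wR ax⊥

  ∧L : Deriv C 𝒰 ((A ∷ B ∷ []) ⇒ Δ) → Deriv C 𝒰 (((A ∧ B) ∷ []) ⇒ Δ)
  ∧L d = cL (∧L₁ (exch (swap _ _ ↭-refl) (∧L₂ (exch (swap _ _ ↭-refl) d))))

  ∧L⁻ : Deriv C 𝒰 (((A ∧ B) ∷ []) ⇒ Δ) → Deriv C 𝒰 ((A ∷ B ∷ []) ⇒ Δ)
  ∧L⁻ = cut (∧R (exch (swap _ _ ↭-refl) (wL ax)) (wL ax))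

  ∨-case : 𝒰 ⊢ D ≤ (A ∨ B) → 𝒰 ⊢ (A ∧ D) ≤ E → 𝒰 ⊢ (B ∧ D) ≤ E → 𝒰 ⊢ D ≤ E
  ∨-case d e f = cL (cut d (ruleD (∧L⁻ e) (∧L⁻ f)))

  ∇-∧ : 𝒰 ⊢ (∇ A ∧ ∇ B) ≤ ∇ (A ∧ B)
  ∇-∧ = ∧L (ruleN (∧L⁻ ax))

  ∇-⊤ : 𝒰 ⊢ A ≤ ∇ ⊤'
  ∇-⊤ = wL (ruleN ax⊤)

  ⇾-curry : 𝒰 ⊢ (∇ A ∧ B) ≤ D → 𝒰 ⊢ A ≤ (B ⇾ D)
  ⇾-curry d = ⇾R (exch (swap _ _ ↭-refl) (∧L⁻ d))

  ⇾-eval : 𝒰 ⊢ (∇ (A ⇾ B) ∧ A) ≤ B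
  ⇾-eval = ∧L (⇾L ax (exch (swap _ _ ↭-refl) (wL ax)))

  ⊃-curry : (t : T (H C)) → 𝒰 ⊢ (A ∧ B) ≤ D → 𝒰 ⊢ A ≤ ⊃ {_} {t} B D
  ⊃-curry t d = ⊃R t (exch (swap _ _ ↭-refl) (∧L⁻ d))

  ⊃-eval : (t : T (H C)) → 𝒰 ⊢ (⊃ {_} {t} A B ∧ A) ≤ B
  ⊃-eval t = ∧L (⊃L t ax (exch (swap _ _ ↭-refl) (wL ax)))

  ⋀ : List F → F
  ⋀ []      = ⊤'
  ⋀ (A ∷ Γ) = A ∧ ⋀ Γ

  ⌊_⌋ : Maybe F → F
  ⌊ nothing ⌋ = ⊥'
  ⌊ just A ⌋  = A

  ax-∷ : ∀ Γ → Deriv C 𝒰 ((A ∷ Γ) ⇒ just A)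
  ax-∷ Γ = exch (↭-sym (∷↭∷ʳ _ Γ)) (weaken Γ)
    where
    weaken : ∀ Γ → Deriv C 𝒰 ((Γ ++ A ∷ []) ⇒ just A)
    weaken []      = ax
    weaken (_ ∷ Γ) = wL (weaken Γ)

  ⋀-intro : ∀ Γ → Deriv C 𝒰 (Γ ⇒ just (⋀ Γ))
  ⋀-intro []      = ax⊤
  ⋀-intro (_ ∷ Γ) = ∧R (ax-∷ Γ) (wL (⋀-intro Γ))

  ⋀-elim : All (λ B → 𝒰 ⊢ ⋀ Γ ≤ B) Γ
  ⋀-elim {Γ = []}    = []
  ⋀-elim {Γ = _ ∷ _} = π₁ ∷ All.map (π₂ ⨾_) ⋀-elim

  -- One weakened copy of `A` is placed next to `Γ`; each formula of `Γ` is then cut away, and the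
  -- extra `A` this brings in is contracted at once. The initial copy also settles empty `Γ`.
  discharge : All (λ B → 𝒰 ⊢ A ≤ B) Γ → Deriv C 𝒰 (Γ ⇒ Δ) → Deriv C 𝒰 ((A ∷ []) ⇒ Δ)
  discharge {𝒰 = 𝒰} {A = A} {Δ = Δ} ds d = go ds (exch (∷↭∷ʳ A _) (wL d))
    where
    go : ∀ {Γ} → All (λ B → 𝒰 ⊢ A ≤ B) Γ → Deriv C 𝒰 ((Γ ++ A ∷ []) ⇒ Δ) → Deriv C 𝒰 ((A ∷ []) ⇒ Δ)
    go []               d = d
    go {_ ∷ Γ} (e ∷ es) d = go es (exch (∷↭∷ʳ A Γ) (cL (exch contract (cut e d))))
      where
      contract : (Γ ++ A ∷ []) ++ A ∷ [] ↭ A ∷ A ∷ Γ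
      contract = trans (↭-sym (∷↭∷ʳ A (Γ ++ A ∷ []))) (prep A (↭-sym (∷↭∷ʳ A Γ)))

  sequent⇒≤ : Deriv C 𝒰 (Γ ⇒ Δ) → 𝒰 ⊢ ⋀ Γ ≤ ⌊ Δ ⌋
  sequent⇒≤ {Δ = nothing} = wR ∘ discharge ⋀-elim
  sequent⇒≤ {Δ = just _}  = discharge ⋀-elim

  ≤⇒sequent : ∀ Γ Δ → 𝒰 ⊢ ⋀ Γ ≤ ⌊ Δ ⌋ → Deriv C 𝒰 (Γ ⇒ Δ)
  ≤⇒sequent Γ nothing  d = cut (⋀-intro Γ) (cut d ax⊥)
  ≤⇒sequent Γ (just _) d = cut (⋀-intro Γ) d

-- Two theories, their shared formulas, and points

Side : Set
Side = Bool

module Amalgam (C : Choice) (𝒰 : Side → SeqSet C) (var : Side → ℕ → Set) where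

  open Calculus C

  private variable
    s t r : Side
    a u v w x x′ y y′ z : F

  Over : Side → F → Set
  Over s x = ∀ n → OccF n x → var s n

  Shared : F → Set
  Shared x = ∀ s → Over s x

  shared-⊤ : Shared ⊤'
  shared-⊤ _ _ ()

  shared-⊥ : Shared ⊥'
  shared-⊥ _ _ ()

  shared-∧ : Shared x → Shared y → Shared (x ∧ y)
  shared-∧ f g s n (∧ˡ o) = f s n o
  shared-∧ f g s n (∧ʳ o) = g s n o

  shared-∨ : Shared x → Shared y → Shared (x ∨ y)
  shared-∨ f g s n (∨ˡ o) = f s n o
  shared-∨ f g s n (∨ʳ o) = g s n o

  shared-∇ : Shared x → Shared (∇ x)
  shared-∇ f s n (∇ᶠ o) = f s n o

  shared-⇾ : Shared x → Shared y → Shared (x ⇾ y)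
  shared-⇾ f g s n (⇾ˡ o) = f s n o
  shared-⇾ f g s n (⇾ʳ o) = g s n o

  shared-⊃ : (h : T (H C)) → Shared x → Shared y → Shared (⊃ {_} {h} x y)
  shared-⊃ h f g s n (⊃ˡ o) = f s n o
  shared-⊃ h f g s n (⊃ʳ o) = g s n o

  other : s ≢ t → r ≢ s → t ≡ r
  other s≢t r≢s = ≡-trans (¬-not (s≢t ∘ sym)) (sym (¬-not r≢s))

  -- A point stands for the meet, or for the join, of its two components.
  Point : Set
  Point = Side → F

  private variable
    p p′ q q′ : Point
    Γ : List F

  infix 4 _≤ₚ_
  _≤ₚ_ : Point → Point → Set
  p ≤ₚ q = ∀ s → 𝒰 s ⊢ p s ≤ q s

  reflₚ : p ≤ₚ p
  reflₚ _ = ax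

  transₚ : p ≤ₚ p′ → p′ ≤ₚ q → p ≤ₚ q
  transₚ f g s = f s ⨾ g s

  -- Abstract, so that only y s x t can be unified with only y s′ x′ t.
  abstract
    only : F → Side → F → Point
    only y s x t with s ≟ t
    ... | yes _ = x
    ... | no  _ = y

    only-self : ∀ y s x → only y s x s ≡ x
    only-self y s x with s ≟ s
    ... | yes _  = refl
    ... | no s≢s = ⊥-elim (s≢s refl)

    only-other : ∀ y x → s ≢ t → only y s x t ≡ y
    only-other {s} {t} y x s≢t with s ≟ t
    ... | yes s≡t = ⊥-elim (s≢t s≡t)
    ... | no _    = refl

  upper : Side → F → Point
  upper = only ⊥'

  lower : Side → F → Point
  lower = only ⊤'

  upper-self : 𝒰 s ⊢ x ≤ upper s x s
  upper-self {s} {x} rewrite only-self ⊥' s x = ax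

  upper-self⁻ : 𝒰 s ⊢ upper s x s ≤ x
  upper-self⁻ {s} {x} rewrite only-self ⊥' s x = ax

  upper-other : s ≢ t → 𝒰 t ⊢ upper s x t ≤ y
  upper-other {x = x} s≢t rewrite only-other ⊥' x s≢t = ⊥-min

  lower-self : 𝒰 s ⊢ lower s x s ≤ x
  lower-self {s} {x} rewrite only-self ⊤' s x = ax

  lower-self⁻ : 𝒰 s ⊢ x ≤ lower s x s
  lower-self⁻ {s} {x} rewrite only-self ⊤' s x = ax

  lower-other : s ≢ t → 𝒰 t ⊢ y ≤ lower s x t
  lower-other {x = x} s≢t rewrite only-other ⊤' x s≢t = ⊤-max

  upper-mono : 𝒰 s ⊢ x ≤ y → upper s x ≤ₚ upper s y
  upper-mono {s} d t with s ≟ t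
  ... | yes refl = upper-self⁻ ⨾ d ⨾ upper-self
  ... | no s≢t   = upper-other s≢t

  lower-max : 𝒰 s ⊢ p s ≤ x → p ≤ₚ lower s x
  lower-max {s} d t with s ≟ t
  ... | yes refl = d ⨾ lower-self⁻
  ... | no s≢t   = lower-other s≢t

  infix 21 _＠_∙_
  -- The meet of the point `p` with `u` taken on side `s`; the other component only gains a conjunct
  -- `⊤'`.
  _＠_∙_ : F → Side → Point → Point
  (u ＠ s ∙ p) t = lower s u t ∧ p t

  ＠-≤ : u ＠ s ∙ p ≤ₚ p
  ＠-≤ _ = π₂

  ＠-self : 𝒰 s ⊢ (lower s u s ∧ x) ≤ u
  ＠-self = π₁ ⨾ lower-self

  ＠-max : q ≤ₚ p → 𝒰 s ⊢ q s ≤ u → q ≤ₚ u ＠ s ∙ p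
  ＠-max f d t = ⟨ lower-max d t , f t ⟩

  ＠-mono : p ≤ₚ q → u ＠ s ∙ p ≤ₚ u ＠ s ∙ q
  ＠-mono f = ＠-max (transₚ ＠-≤ f) ＠-self

  -- Entailment in the pushout

  infix 4 _≼_
  _≼_ : F → F → Set
  x ≼ y = ∀ s → 𝒰 s ⊢ x ≤ y

  -- Ent p q x y says that p true ∧ p false ∧ x ≤ q true ∨ q false ∨ y in the
  -- pushout: the two sides may only communicate by cuts on shared formulas.
  data Ent (p q : Point) : F → F → Set where
    side : ∀ {x y} s → 𝒰 s ⊢ (p s ∧ x) ≤ (q s ∨ y) → Ent p q x y
    cutₑ : ∀ {x y z} → Shared z → Ent p q x (y ∨ z) → Ent p q (z ∧ x) y → Ent p q x y

  Ent-mono : p′ ≤ₚ p → q ≤ₚ q′ → x′ ≼ x → y ≼ y′ → Ent p q x y → Ent p′ q′ x′ y′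
  Ent-mono f g i j (side s d) =
    side s (⟨ π₁ ⨾ f s , π₂ ⨾ i s ⟩ ⨾ d ⨾ ∨L (g s ⨾ ι₁) (j s ⨾ ι₂))
  Ent-mono f g i j (cutₑ sh d e) =
    cutₑ sh (Ent-mono f g i (λ s → ∨L (j s ⨾ ι₁) ι₂) d)
            (Ent-mono f g (λ s → ⟨ π₁ , π₂ ⨾ i s ⟩) j e)

  -- The cuts of both derivations permute below the merge, so only the combination of two `side`
  -- steps has to be supplied.
  Ent-merge : ∀ {p₁ p₂ q₁ q₂} →
    (∀ {s t x y x′ y′} → 𝒰 s ⊢ (p₁ s ∧ x) ≤ (q₁ s ∨ y) → 𝒰 t ⊢ (p₂ t ∧ x′) ≤ (q₂ t ∨ y′) →
      Ent p q (x ∧ x′) (y ∨ y′)) →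
    Ent p₁ q₁ x y → Ent p₂ q₂ x′ y′ → Ent p q (x ∧ x′) (y ∨ y′)
  Ent-merge m (cutₑ sh d e) f =
    cutₑ sh (Ent-mono reflₚ reflₚ (λ _ → ax) (λ _ → ∨L (∨L (ι₁ ⨾ ι₁) ι₂) (ι₂ ⨾ ι₁)) (Ent-merge m d f))
            (Ent-mono reflₚ reflₚ (λ _ → ⟨ ⟨ π₁ , π₂ ⨾ π₁ ⟩ , π₂ ⨾ π₂ ⟩) (λ _ → ax) (Ent-merge m e f))
  Ent-merge m d@(side _ _) (cutₑ sh e f) =
    cutₑ sh (Ent-mono reflₚ reflₚ (λ _ → ax) (λ _ → ∨L (ι₁ ⨾ ι₁) (∨L (ι₂ ⨾ ι₁) ι₂)) (Ent-merge m d e))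
            (Ent-mono reflₚ reflₚ (λ _ → ⟨ π₂ ⨾ π₁ , ⟨ π₁ , π₂ ⨾ π₂ ⟩ ⟩) (λ _ → ax) (Ent-merge m d f))
  Ent-merge m (side _ d) (side _ e) = m d e

  Ent-⊤⊥ : Ent p q (⊤' ∧ ⊤') (⊥' ∨ ⊥') → Ent p q ⊤' ⊥'
  Ent-⊤⊥ = Ent-mono reflₚ reflₚ (λ _ → ⟨ ax , ax ⟩) (λ _ → ∨L ax ax)

  -- The principal ideal of the pushout generated by x on side s.
  ↓ : Side → F → Point → Set
  ↓ s x p = Ent p (upper s x) ⊤' ⊥'

  -- Ideals of the pushout

  record Ideal (U : Point → Set) : Set where
    field
      down  : p ≤ₚ q → U q → U p
      empty : ∀ s → 𝒰 s ⊢ p s ≤ ⊥' → U p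
      split : ∀ s → 𝒰 s ⊢ p s ≤ (u ∨ v) → U (u ＠ s ∙ p) → U (v ＠ s ∙ p) → U p
      shift : ∀ s t → Shared a → 𝒰 s ⊢ p s ≤ a → U (a ＠ t ∙ p) → U p

    shift-all : ∀ s → Shared a → 𝒰 s ⊢ p s ≤ a → U (λ t → a ∧ p t) → U p
    shift-all s sh d i =
      shift s true sh d (shift s false sh (π₂ ⨾ d)
        (down (λ { true → ⟨ π₂ ⨾ π₁ ⨾ lower-self , π₂ ⨾ π₂ ⟩ ; false → ⟨ π₁ ⨾ lower-self , π₂ ⨾ π₂ ⟩ }) i))

  open Ideal

  ↓-side : ∀ s → 𝒰 s ⊢ p s ≤ x → ↓ s x p
  ↓-side s d = side s (π₁ ⨾ d ⨾ upper-self ⨾ ι₁)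

  ↓-mono : 𝒰 s ⊢ x ≤ y → ↓ s x p → ↓ s y p
  ↓-mono d = Ent-mono reflₚ (upper-mono d) (λ _ → ax) (λ _ → ax)

  -- A `side` step away from `r` sees neither `u` nor `v` and serves alone; two steps on `r` are
  -- combined by eliminating `u ∨ v`.
  Ent-split : ∀ r → 𝒰 r ⊢ p r ≤ (u ∨ v) → Ent (u ＠ r ∙ p) q x y → Ent (v ＠ r ∙ p) q x′ y′ →
              Ent p q (x ∧ x′) (y ∨ y′)
  Ent-split {p = p} {u} {v} {q} r h = Ent-merge merge
    where
    merge : 𝒰 s ⊢ ((u ＠ r ∙ p) s ∧ x) ≤ (q s ∨ y) → 𝒰 t ⊢ ((v ＠ r ∙ p) t ∧ x′) ≤ (q t ∨ y′) →
            Ent p q (x ∧ x′) (y ∨ y′)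
    merge {s = s} {t = t} d e with r ≟ s | r ≟ t
    ... | no r≢s   | _        =
      side s (⟨ ⟨ lower-other r≢s , π₁ ⟩ , π₂ ⨾ π₁ ⟩ ⨾ d ⨾ ∨L ι₁ (ι₁ ⨾ ι₂))
    ... | yes refl | no r≢t   =
      side t (⟨ ⟨ lower-other r≢t , π₁ ⟩ , π₂ ⨾ π₂ ⟩ ⨾ e ⨾ ∨L ι₁ (ι₂ ⨾ ι₂))
    ... | yes refl | yes refl =
      side r (∨-case (π₁ ⨾ h)
        (⟨ ⟨ π₁ ⨾ lower-self⁻ , π₂ ⨾ π₁ ⟩ , π₂ ⨾ π₂ ⨾ π₁ ⟩ ⨾ d ⨾ ∨L ι₁ (ι₁ ⨾ ι₂))
        (⟨ ⟨ π₁ ⨾ lower-self⁻ , π₂ ⨾ π₁ ⟩ , π₂ ⨾ π₂ ⨾ π₂ ⟩ ⨾ e ⨾ ∨L ι₁ (ι₂ ⨾ ι₂)))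

  -- The formula context is visible to both sides, so moving `a` there only strengthens the
  -- hypotheses. This lets `shift` become a cut.
  Ent-＠ : ∀ t → Ent (a ＠ t ∙ p) q x y → Ent p q (a ∧ x) y
  Ent-＠ {a} {p} {x = x} t (side s d) =
    side s (⟨ ⟨ lower-max {p = λ s → p s ∧ (a ∧ x)} (π₂ ⨾ π₁) s , π₁ ⟩ , π₂ ⨾ π₂ ⟩ ⨾ d)
  Ent-＠ t (cutₑ sh d e) =
    cutₑ sh (Ent-＠ t d)
            (Ent-mono reflₚ reflₚ (λ _ → ⟨ π₂ ⨾ π₁ , ⟨ π₁ , π₂ ⨾ π₂ ⟩ ⟩) (λ _ → ax) (Ent-＠ t e))

  ↓-ideal : ∀ s x → Ideal (↓ s x)
  ↓-ideal s x .down f = Ent-mono f reflₚ (λ _ → ax) (λ _ → ax)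
  ↓-ideal s x .empty t d = side t (π₁ ⨾ d ⨾ ⊥-min)
  ↓-ideal s x .split r h d e = Ent-⊤⊥ (Ent-split r h d e)
  ↓-ideal s x .shift r t sh d e = cutₑ sh (side r (π₁ ⨾ d ⨾ ι₂ ⨾ ι₂)) (Ent-＠ t e)

  ↓-∧ : ↓ s x p → ↓ s y p → ↓ s (x ∧ y) p
  ↓-∧ {s} {x} {p} {y} d e = Ent-⊤⊥ (Ent-merge merge d e)
    where
    merge : 𝒰 t ⊢ (p t ∧ u) ≤ (upper s x t ∨ v) → 𝒰 r ⊢ (p r ∧ w) ≤ (upper s y r ∨ z) →
            Ent p (upper s (x ∧ y)) (u ∧ w) (v ∨ z)
    merge {t = t} {r = r} d e with s ≟ t | s ≟ r
    ... | no s≢t   | _        =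
      side t (⟨ π₁ , π₂ ⨾ π₁ ⟩ ⨾ d ⨾ ∨L (upper-other s≢t) (ι₁ ⨾ ι₂))
    ... | yes refl | no s≢r   =
      side r (⟨ π₁ , π₂ ⨾ π₂ ⟩ ⨾ e ⨾ ∨L (upper-other s≢r) (ι₂ ⨾ ι₂))
    ... | yes refl | yes refl =
      side s (∨-case (⟨ π₁ , π₂ ⨾ π₁ ⟩ ⨾ d)
        (∨-case (π₂ ⨾ ⟨ π₁ , π₂ ⨾ π₂ ⟩ ⨾ e)
          (⟨ π₂ ⨾ π₁ ⨾ upper-self⁻ , π₁ ⨾ upper-self⁻ ⟩ ⨾ upper-self ⨾ ι₁)
          (π₁ ⨾ ι₂ ⨾ ι₂))
        (π₁ ⨾ ι₁ ⨾ ι₂))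

  ↓-shared : ∀ s t → Shared a → 𝒰 t ⊢ p t ≤ a → ↓ s a p
  ↓-shared s t sh d = ↓-ideal s _ .shift t s sh d (↓-side s ＠-self)

  -- The derivation is replayed inside `W`: a `side` step becomes `split`, and a cut becomes a split
  -- whose shared half is passed to both sides by `shift`.
  ↓-least : ∀ {W} → Ideal W → W (lower s x) → ↓ s x p → W p
  ↓-least {s} {x} {p} {W} I i d = go d reflₚ (λ _ → ⊤-max) (λ t → I .empty t ＠-self)
    where
    cover : ∀ t → W (upper s x t ＠ t ∙ p′)
    cover t with s ≟ t
    ... | yes refl = I .down (lower-max (＠-self ⨾ upper-self⁻)) i
    ... | no s≢t   = I .empty t (＠-self ⨾ upper-other s≢t)

    -- Invariant: `p′` lies below `p` and `u`, and its restriction to `v` on any side is already in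
    -- `W`.
    go : Ent p (upper s x) u v → p′ ≤ₚ p → (∀ t → 𝒰 t ⊢ p′ t ≤ u) → (∀ t → W (v ＠ t ∙ p′)) → W p′
    go (side t d) f g j = I .split t (⟨ f t , g t ⟩ ⨾ d) (cover t) (j t)
    go (cutₑ sh d e) f g j = go d f g λ t →
      I .split t ＠-self
        (I .down (＠-mono ＠-≤) (j t))
        (shift-all I t sh ＠-self
          (go e (λ s → π₂ ⨾ π₂ ⨾ π₂ ⨾ f s) (λ s → ⟨ π₁ , π₂ ⨾ π₂ ⨾ π₂ ⨾ g s ⟩)
              (λ r → I .down (＠-mono (λ s → π₂ ⨾ π₂ ⨾ π₂)) (j r))))

  -- The whole derivation can be evaluated on side `s`: the points are trivial on the other side, so
  -- its steps relate shared formulas only and are imported by `sub`.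
  ↓-conservative : (∀ {x y} → Shared x → Shared y → (∀ t → 𝒰 t ⊢ x ≤ y → 𝒰 s ⊢ x ≤ y)) →
                   ↓ s y (lower s x) → 𝒰 s ⊢ x ≤ y
  ↓-conservative {s} {y} {x} sub d = ⟨ ax , ⊤-max ⟩ ⨾ go shared-⊤ shared-⊥ d ⨾ ∨L ax ⊥-min
    where
    go : Shared u → Shared v → Ent (lower s x) (upper s y) u v → 𝒰 s ⊢ (x ∧ u) ≤ (y ∨ v)
    go f g (side t d) with s ≟ t
    ... | yes refl = ⟨ π₁ ⨾ lower-self⁻ , π₂ ⟩ ⨾ d ⨾ ∨L (upper-self⁻ ⨾ ι₁) ι₂
    ... | no s≢t   = π₂ ⨾ sub f g t (⟨ lower-other s≢t , ax ⟩ ⨾ d ⨾ ∨L (upper-other s≢t) ax) ⨾ ι₂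
    go f g (cutₑ h d e) =
      ∨-case (go f (shared-∨ g h) d)
        (π₁ ⨾ ι₁)
        (∨-case π₁ (π₁ ⨾ ι₂) (⟨ π₂ ⨾ π₂ ⨾ π₁ , ⟨ π₁ , π₂ ⨾ π₂ ⨾ π₂ ⟩ ⟩ ⨾ go (shared-∧ h f) g e))

  -- Residuated operators: `∇` with `⇾`, the identity with `⊃`

  record Residuated (f : F → F) (_▷_ : F → F → F) : Set where
    field
      mono     : 𝒰 s ⊢ x ≤ y → 𝒰 s ⊢ f x ≤ f y
      f-∧      : 𝒰 s ⊢ (f x ∧ f y) ≤ f (x ∧ y)
      f-⊤      : 𝒰 s ⊢ x ≤ f ⊤'
      shared-f : Shared x → Shared (f x)
      shared-▷ : Shared x → Shared y → Shared (x ▷ y)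
      curry    : 𝒰 s ⊢ (f x ∧ y) ≤ z → 𝒰 s ⊢ x ≤ (y ▷ z)
      eval     : 𝒰 s ⊢ (f (x ▷ y) ∧ x) ≤ y

    uncurry : 𝒰 s ⊢ x ≤ (⊤' ▷ y) → 𝒰 s ⊢ f x ≤ y
    uncurry d = ⟨ mono d , ⊤-max ⟩ ⨾ eval

    f-⊥ : 𝒰 s ⊢ f ⊥' ≤ x
    f-⊥ = uncurry ⊥-min

    f-∨ : 𝒰 s ⊢ f (x ∨ y) ≤ (f x ∨ f y)
    f-∨ = uncurry (∨L (curry (π₁ ⨾ ι₁)) (curry (π₁ ⨾ ι₂)))

    f-lower : ∀ t → lower t (f x) ≤ₚ f ∘ lower t x
    f-lower t s with t ≟ s
    ... | yes refl = lower-self ⨾ mono lower-self⁻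
    ... | no t≢s   = f-⊤ ⨾ mono (lower-other t≢s)

    f-＠ : ∀ t → f x ＠ t ∙ (f ∘ p) ≤ₚ f ∘ (x ＠ t ∙ p)
    f-＠ t s = ⟨ π₁ ⨾ f-lower t s , π₂ ⟩ ⨾ f-∧

    -- `f` preserves finite meets, finite joins (being left adjoint to `⊤' ▷_`) and shared formulas,
    -- so each closure condition of `W` pulls back.
    preimage : ∀ {W} → Ideal W → Ideal (λ p → W (f ∘ p))
    preimage I .down g = I .down (λ s → mono (g s))
    preimage I .empty s d = I .empty s (mono d ⨾ f-⊥)
    preimage I .split s d i j =
      I .split s (mono d ⨾ f-∨) (I .down (f-＠ s) i) (I .down (f-＠ s) j)
    preimage I .shift s t sh d i = I .shift s t (shared-f sh) (mono d) (I .down (f-＠ t) i)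

    -- Everything the other side contributes to the derivation is collected in
    -- one shared formula a; a contribution f (p t) ∧ x ≤ y becomes p t ≤ x ▷ y.
    ↓-▷ : ↓ s y (x ＠ s ∙ (f ∘ p)) → ↓ s (x ▷ y) p
    ↓-▷ {s} {y} {x} {p} d with go shared-⊤ shared-⊥ d
      where
      go : Shared u → Shared v → Ent (x ＠ s ∙ (f ∘ p)) (upper s y) u v →
           ∃ λ a → ↓ s a p × 𝒰 s ⊢ ((x ∧ f (p s)) ∧ (f a ∧ u)) ≤ (y ∨ v)
      go su sv (side t d) with s ≟ t
      ... | yes refl = ⊤' , ↓-side s ⊤-max ,
        ⟨ ⟨ π₁ ⨾ π₁ ⨾ lower-self⁻ , π₁ ⨾ π₂ ⟩ , π₂ ⨾ π₂ ⟩ ⨾ d ⨾ ∨L (upper-self⁻ ⨾ ι₁) ι₂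
      ... | no s≢t   =
        _ , ↓-shared s t (shared-▷ su sv) (curry (⟨ ⟨ lower-other s≢t , π₁ ⟩ , π₂ ⟩ ⨾ d ⨾ ∨L (upper-other s≢t) ax)) ,
        π₂ ⨾ eval ⨾ ι₂
      go su sv (cutₑ sz d e) with go su (shared-∨ sv sz) d | go (shared-∧ sz su) sv e
      ... | a , i , d′ | b , j , e′ =
        (a ∧ b) , ↓-∧ i j ,
        ∨-case (⟨ π₁ , ⟨ π₂ ⨾ π₁ ⨾ mono π₁ , π₂ ⨾ π₂ ⟩ ⟩ ⨾ d′)
          (π₁ ⨾ ι₁)
          (∨-case π₁ (π₁ ⨾ ι₂)
            (⟨ π₂ ⨾ π₂ ⨾ π₁ , ⟨ π₂ ⨾ π₂ ⨾ π₂ ⨾ π₁ ⨾ mono π₂ , ⟨ π₁ , π₂ ⨾ π₂ ⨾ π₂ ⨾ π₂ ⟩ ⟩ ⟩ ⨾ e′))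
    ... | a , i , d′ =
      ↓-mono
        (curry (⟨ ⟨ π₂ , π₁ ⨾ mono π₁ ⟩ , ⟨ π₁ ⨾ mono π₂ , ⊤-max ⟩ ⟩ ⨾ d′ ⨾ ∨L ax ⊥-min))
        (↓-∧ (↓-side s ax) i)

  open Residuated

  ∇-residuated : Residuated ∇ _⇾_
  ∇-residuated = record
    { mono = mod ; f-∧ = ∇-∧ ; f-⊤ = ∇-⊤ ; shared-f = shared-∇ ; shared-▷ = shared-⇾
    ; curry = ⇾-curry ; eval = ⇾-eval }

  id-residuated : (h : T (H C)) → Residuated id (⊃ {_} {h})
  id-residuated h = record
    { mono = id ; f-∧ = ax ; f-⊤ = ⊤-max ; shared-f = id ; shared-▷ = shared-⊃ h
    ; curry = ⊃-curry h ; eval = ⊃-eval h }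

  -- Implication and generation of ideals

  infixr 5 _⊸_
  _⊸_ : (Point → Set) → (Point → Set) → Point → Set
  (U ⊸ W) p = ∀ q → q ≤ₚ p → U q → W q

  ⊸-ideal : ∀ {U W} → (∀ {p q} → p ≤ₚ q → U q → U p) → Ideal W → Ideal (U ⊸ W)
  ⊸-ideal U↓ I .down f i q g = i q (transₚ g f)
  ⊸-ideal U↓ I .empty s d q g _ = I .empty s (g s ⨾ d)
  ⊸-ideal U↓ I .split s d i j q g k =
    I .split s (g s ⨾ d) (i _ (＠-mono g) (U↓ ＠-≤ k)) (j _ (＠-mono g) (U↓ ＠-≤ k))
  ⊸-ideal U↓ I .shift s t sh d i q g k =
    I .shift s t sh (g s ⨾ d) (i _ (＠-mono g) (U↓ ＠-≤ k))

  data Cl (U : Point → Set) : Point → Set where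
    incl   : ∀ {p} → U p → Cl U p
    downᶜ  : ∀ {p q} → p ≤ₚ q → Cl U q → Cl U p
    emptyᶜ : ∀ {p} s → 𝒰 s ⊢ p s ≤ ⊥' → Cl U p
    splitᶜ : ∀ {p u v} s → 𝒰 s ⊢ p s ≤ (u ∨ v) → Cl U (u ＠ s ∙ p) → Cl U (v ＠ s ∙ p) → Cl U p
    shiftᶜ : ∀ {p a} s t → Shared a → 𝒰 s ⊢ p s ≤ a → Cl U (a ＠ t ∙ p) → Cl U p

  Cl-ideal : ∀ {U} → Ideal (Cl U)
  Cl-ideal = record { down = downᶜ ; empty = emptyᶜ ; split = splitᶜ ; shift = shiftᶜ }

  Cl-least : ∀ {U W} → Ideal W → (∀ {p} → U p → W p) → Cl U p → W p
  Cl-least I f (incl i)            = f i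
  Cl-least I f (downᶜ g i)         = I .down g (Cl-least I f i)
  Cl-least I f (emptyᶜ s d)        = I .empty s d
  Cl-least I f (splitᶜ s d i j)    = I .split s d (Cl-least I f i) (Cl-least I f j)
  Cl-least I f (shiftᶜ s t sh d i) = I .shift s t sh d (Cl-least I f i)

  -- Distributivity of the ideal lattice: only generators below p matter.
  Cl-elim : ∀ {U W} → Ideal W → Cl U p → (∀ {q r} → U q → r ≤ₚ q → r ≤ₚ p → W r) → W p
  Cl-elim {p} I i f =
    Cl-least (⊸-ideal {U = _≤ₚ p} transₚ I) (λ j r g h → f j g h) i p reflₚ reflₚ

  -- Interpretation of formulas as ideals

  -- An atom is a join over the sides it belongs to, so that membership in var s
  -- need not be decidable.
  ⟦_⟧ : F → Point → Set
  ⟦ atom n ⟧ = Cl (λ p → ∃ λ s → var s n × ↓ s (atom n) p)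
  ⟦ A ∧ B ⟧ p = ⟦ A ⟧ p × ⟦ B ⟧ p
  ⟦ A ∨ B ⟧ = Cl (λ p → ⟦ A ⟧ p ⊎ ⟦ B ⟧ p)
  ⟦ A ⇾ B ⟧ p = (⟦ A ⟧ ⊸ ⟦ B ⟧) (∇ ∘ p)
  ⟦ ⊤' ⟧ p = ⊤
  ⟦ ⊥' ⟧ = Cl (λ _ → ⊥)
  ⟦ ∇ A ⟧ = Cl (λ p → ∃ λ q → p ≤ₚ ∇ ∘ q × ⟦ A ⟧ q)
  ⟦ ⊃ A B ⟧ = ⟦ A ⟧ ⊸ ⟦ B ⟧

  ⟦⟧-ideal : ∀ A → Ideal ⟦ A ⟧
  ⟦⟧-ideal (atom n) = Cl-ideal
  ⟦⟧-ideal (A ∧ B) = record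
    { down  = λ f (i , j) → ⟦⟧-ideal A .down f i , ⟦⟧-ideal B .down f j
    ; empty = λ s d → ⟦⟧-ideal A .empty s d , ⟦⟧-ideal B .empty s d
    ; split = λ s d (i , j) (i′ , j′) → ⟦⟧-ideal A .split s d i i′ , ⟦⟧-ideal B .split s d j j′
    ; shift = λ s t sh d (i , j) → ⟦⟧-ideal A .shift s t sh d i , ⟦⟧-ideal B .shift s t sh d j
    }
  ⟦⟧-ideal (A ∨ B) = Cl-ideal
  ⟦⟧-ideal (A ⇾ B) = preimage ∇-residuated (⊸-ideal (⟦⟧-ideal A .down) (⟦⟧-ideal B))
  ⟦⟧-ideal ⊤' = record
    { down = λ _ _ → tt ; empty = λ _ _ → tt ; split = λ _ _ _ _ → tt ; shift = λ _ _ _ _ _ → tt }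
  ⟦⟧-ideal ⊥' = Cl-ideal
  ⟦⟧-ideal (∇ A) = Cl-ideal
  ⟦⟧-ideal (⊃ A B) = ⊸-ideal (⟦⟧-ideal A .down) (⟦⟧-ideal B)

  -- Over the variables of `s` the interpretation is a principal ideal. Both inclusions are proved
  -- together because implication reverses the inclusion for its antecedent.
  ⟦⟧⇒↓ : ∀ A → Over s A → ⟦ A ⟧ p → ↓ s A p
  ↓⇒⟦⟧ : ∀ A → Over s A → ↓ s A p → ⟦ A ⟧ p
  ⟦⟧-lower : ∀ A → Over s A → ⟦ A ⟧ (lower s A)

  ▷-lower : ∀ {f _▷_} → Residuated f _▷_ → ∀ A B → Over s A → Over s B →
            (⟦ A ⟧ ⊸ ⟦ B ⟧) (f ∘ lower s (A ▷ B))
  ▷-lower {s} ρ A B oA oB q g i =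
    ↓⇒⟦⟧ B oB (↓-mono (eval ρ) (↓-∧ (↓-side s (g s ⨾ mono ρ lower-self)) (⟦⟧⇒↓ A oA i)))

  -- It suffices to test the implication at `f ∘ p` met with `A` on side `s`; `↓-▷` then discharges
  -- `A`.
  ⊸⇒↓ : ∀ {f _▷_} → Residuated f _▷_ → ∀ A B → Over s A → Over s B →
        (⟦ A ⟧ ⊸ ⟦ B ⟧) (f ∘ p) → ↓ s (A ▷ B) p
  ⊸⇒↓ {s} ρ A B oA oB i =
    ↓-▷ ρ (⟦⟧⇒↓ B oB (i _ ＠-≤ (↓⇒⟦⟧ A oA (↓-side s ＠-self))))

  ⟦⟧⇒↓ {s} (atom n) o i = Cl-least (↓-ideal s _) agree i
    where
    agree : ∀ {p} → (∃ λ t → var t n × ↓ t (atom n) p) → ↓ s (atom n) p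
    agree (t , vt , d) with s ≟ t
    ... | yes refl = d
    -- With only two sides, an atom belonging to both `s` and `t` is shared, so it can be shifted
    -- from `t` to `s`.
    ... | no s≢t   = ↓-least (↓-ideal s _) (↓-shared s t shared lower-self) d
      where
      shared : Shared (atom n)
      shared r _ here with r ≟ s
      ... | yes refl = o n here
      ... | no r≢s   = subst (λ r → var r n) (other s≢t r≢s) vt
  ⟦⟧⇒↓ (A ∧ B) o (i , j) = ↓-∧ (⟦⟧⇒↓ A (λ n → o n ∘ ∧ˡ) i) (⟦⟧⇒↓ B (λ n → o n ∘ ∧ʳ) j)
  ⟦⟧⇒↓ {s} (A ∨ B) o = Cl-least (↓-ideal s _) λ
    { (inj₁ i) → ↓-mono ι₁ (⟦⟧⇒↓ A (λ n → o n ∘ ∨ˡ) i)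
    ; (inj₂ i) → ↓-mono ι₂ (⟦⟧⇒↓ B (λ n → o n ∘ ∨ʳ) i) }
  ⟦⟧⇒↓ (A ⇾ B) o = ⊸⇒↓ ∇-residuated A B (λ n → o n ∘ ⇾ˡ) (λ n → o n ∘ ⇾ʳ)
  ⟦⟧⇒↓ {s} ⊤' o _ = ↓-side s ⊤-max
  ⟦⟧⇒↓ {s} ⊥' o = Cl-least (↓-ideal s _) λ ()
  ⟦⟧⇒↓ {s} (∇ A) o = Cl-least (↓-ideal s _) λ (q , g , i) →
    ↓-ideal s _ .down g
      (↓-least (preimage ∇-residuated (↓-ideal s _)) (↓-side s (mod lower-self)) (⟦⟧⇒↓ A (λ n → o n ∘ ∇ᶠ) i))
  ⟦⟧⇒↓ (⊃ {_} {h} A B) o = ⊸⇒↓ (id-residuated h) A B (λ n → o n ∘ ⊃ˡ) (λ n → o n ∘ ⊃ʳ)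

  ↓⇒⟦⟧ A o = ↓-least (⟦⟧-ideal A) (⟦⟧-lower A o)

  ⟦⟧-lower {s} (atom n) o = incl (s , o n here , ↓-side s lower-self)
  ⟦⟧-lower {s} (A ∧ B) o =
    ⟦⟧-ideal A .down (lower-max (lower-self ⨾ π₁)) (⟦⟧-lower A (λ n → o n ∘ ∧ˡ)) ,
    ⟦⟧-ideal B .down (lower-max (lower-self ⨾ π₂)) (⟦⟧-lower B (λ n → o n ∘ ∧ʳ))
  ⟦⟧-lower {s} (A ∨ B) o = splitᶜ s lower-self
    (incl (inj₁ (⟦⟧-ideal A .down (lower-max ＠-self) (⟦⟧-lower A (λ n → o n ∘ ∨ˡ)))))
    (incl (inj₂ (⟦⟧-ideal B .down (lower-max ＠-self) (⟦⟧-lower B (λ n → o n ∘ ∨ʳ)))))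
  ⟦⟧-lower (A ⇾ B) o = ▷-lower ∇-residuated A B (λ n → o n ∘ ⇾ˡ) (λ n → o n ∘ ⇾ʳ)
  ⟦⟧-lower ⊤' o = tt
  ⟦⟧-lower {s} ⊥' o = emptyᶜ s lower-self
  ⟦⟧-lower {s} (∇ A) o = incl (lower s A , f-lower ∇-residuated s , ⟦⟧-lower A (λ n → o n ∘ ∇ᶠ))
  ⟦⟧-lower (⊃ {_} {h} A B) o = ▷-lower (id-residuated h) A B (λ n → o n ∘ ⊃ˡ) (λ n → o n ∘ ⊃ʳ)

  -- Soundness of the calculus in the ideals

  _⊩_ : Point → List F → Set
  p ⊩ Γ = All (λ A → ⟦ A ⟧ p) Γ

  ⊩-down : p ≤ₚ q → q ⊩ Γ → p ⊩ Γ
  ⊩-down f = All.map (λ {A} → ⟦⟧-ideal A .down f)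

  Valid : SeqC C → Set
  Valid (Γ ⇒ Δ) = ∀ p → p ⊩ Γ → ⟦ ⌊ Δ ⌋ ⟧ p

  -- `∇` on ideals preserves finite meets: by distributivity the witnesses for the single formulas
  -- may be chosen below a common generator, and their meet serves all of `Γ`.
  ∇-⊩ : ∀ Γ → p ⊩ ∇s Γ → Cl (λ p → ∃ λ q → p ≤ₚ ∇ ∘ q × q ⊩ Γ) p
  ∇-⊩ [] [] = incl ((λ _ → ⊤') , (λ _ → ∇-⊤) , [])
  ∇-⊩ (A ∷ Γ) (i ∷ is) =
    Cl-elim Cl-ideal i λ (q , g , j) f h →
    Cl-elim Cl-ideal (downᶜ h (∇-⊩ Γ is)) λ (q′ , g′ , js) f′ h′ →
    incl ((λ s → q s ∧ q′ s) ,
          (λ s → ⟨ h′ s ⨾ f s ⨾ g s , f′ s ⨾ g′ s ⟩ ⨾ ∇-∧) ,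
          ⟦⟧-ideal A .down (λ _ → π₁) j ∷ ⊩-down (λ _ → π₂) js)

  N-valid : ∀ Γ Δ → Valid (Γ ⇒ Δ) → Valid (∇s Γ ⇒ ∇m Δ)
  N-valid Γ (just B) v p is =
    Cl-least Cl-ideal (λ (q , g , js) → incl (q , g , v q js)) (∇-⊩ Γ is)
  N-valid Γ nothing v p is =
    Cl-least Cl-ideal
      (λ (q , g , js) → downᶜ g (Cl-least (preimage ∇-residuated Cl-ideal) (λ ()) (v q js)))
      (∇-⊩ Γ is)

  sound : ∀ {𝒮 S} → (∀ S → 𝒮 S → Valid S) → Deriv C 𝒮 S → Valid S
  sound h (hyp m) = h _ m
  sound h (exch π d) p is = sound h d p (All-resp-↭ (↭-sym π) is)
  sound h ax p (i ∷ []) = i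
  sound h ax⊥ p (i ∷ []) = i
  sound h ax⊤ p [] = tt
  sound h (wL d) p (_ ∷ is) = sound h d p is
  sound h (wR {A = A} d) p is = Cl-least (⟦⟧-ideal A) (λ ()) (sound h d p is)
  sound h (cL d) p (i ∷ is) = sound h d p (i ∷ i ∷ is)
  sound h (cut {Π = Π} d e) p is with ++⁻ Π is
  ... | is₁ , is₂ = sound h e p (sound h d p is₂ ∷ is₁)
  sound h (∧L₁ d) p ((i , _) ∷ is) = sound h d p (i ∷ is)
  sound h (∧L₂ d) p ((_ , i) ∷ is) = sound h d p (i ∷ is)
  sound h (∧R d e) p is = sound h d p is , sound h e p is
  sound h (∨L {Δ} {A} {B} d e) p (i ∷ []) =
    Cl-elim (⟦⟧-ideal ⌊ Δ ⌋) i λ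
      { (inj₁ j) f _ → sound h d _ (⟦⟧-ideal A .down f j ∷ [])
      ; (inj₂ j) f _ → sound h e _ (⟦⟧-ideal B .down f j ∷ []) }
  sound h (∨R₁ d) p is = incl (inj₁ (sound h d p is))
  sound h (∨R₂ d) p is = incl (inj₂ (sound h d p is))
  sound h (mod {A} {B} d) = N-valid (A ∷ []) (just B) (sound h d)
  sound h (⇾L {Δ = Δ} d e) p (i ∷ is) =
    Cl-elim (⟦⟧-ideal ⌊ Δ ⌋) i λ {_} {r} (q , g , j) f k →
      let js = ⊩-down k is
      in sound h e r (j r (transₚ f g) (sound h d r js) ∷ js)
  sound h (⇾R d) p is q f i =
    sound h d q (i ∷ map⁺ (All.map (λ j → incl (p , f , j)) is))
  sound h (ruleN {Γ} {Δ} d) = N-valid Γ Δ (sound h d)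
  sound h (ruleD {Δ = Δ} {A} {B} d e) p (i ∷ is) =
    Cl-elim (⟦⟧-ideal ⌊ Δ ⌋) i λ
      { (inj₁ j) f k → sound h d _ (⟦⟧-ideal A .down f j ∷ ⊩-down k is)
      ; (inj₂ j) f k → sound h e _ (⟦⟧-ideal B .down f j ∷ ⊩-down k is) }
  sound h (ruleR e d) p is = incl (p , (λ _ → ruleR e ax) , sound h d p is)
  sound h (ruleL {Δ = Δ} {A} e d) p (i ∷ is) =
    Cl-elim (⟦⟧-ideal ⌊ Δ ⌋) i λ (q , g , j) f k →
      sound h d _ (⟦⟧-ideal A .down (λ s → f s ⨾ g s ⨾ ruleL e ax) j ∷ ⊩-down k is)
  sound h (ruleFa e d) p is =
    -- By (Fa) and evaluation, `∇ (⊤' ⇾ p s)` is equivalent to `p s`, so this witness is a preimage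
    -- of `p` under `∇`.
    incl ((λ s → ⊤' ⇾ p s) , (λ _ → ruleFa e (wL ax)) , λ q f i →
      sound h d q (i ∷ ⊩-down (λ s → f s ⨾ ⟨ ax , ⊤-max ⟩ ⨾ ⇾-eval) is))
  sound h (⊃L t d e) p (i ∷ is) = sound h e p (i p reflₚ (sound h d p is) ∷ is)
  sound h (⊃R t d) p is q f i = sound h d q (i ∷ ⊩-down f is)

  -- Transfer from one theory to the other

  over-⌊⌋ : ∀ Δ → (∀ n → OccM n Δ → var s n) → Over s ⌊ Δ ⌋
  over-⌊⌋ (just _) f n = f n ∘ just
  over-⌊⌋ nothing f n ()

  ⊩⇒↓ : ∀ Γ → (∀ n → Any (OccF n) Γ → var s n) → p ⊩ Γ → ↓ s (⋀ Γ) p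
  ⊩⇒↓ {s} [] f [] = ↓-side s ⊤-max
  ⊩⇒↓ (A ∷ Γ) f (i ∷ is) = ↓-∧ (⟦⟧⇒↓ A (λ n → f n ∘ here) i) (⊩⇒↓ Γ (λ n → f n ∘ there) is)

  lower-⊩ : ∀ Γ → (∀ n → Any (OccF n) Γ → var s n) → lower s (⋀ Γ) ⊩ Γ
  lower-⊩ [] f = []
  lower-⊩ (A ∷ Γ) f =
    ⟦⟧-ideal A .down (lower-max (lower-self ⨾ π₁)) (⟦⟧-lower A (λ n → f n ∘ here)) ∷
    ⊩-down (lower-max (lower-self ⨾ π₂)) (lower-⊩ Γ (λ n → f n ∘ there))

  -- A premise in the variables of `s` is an inequality on side `s`, where interpretations are
  -- principal ideals and hence monotone in the generator.
  theory-valid : (∀ n → V (𝒰 s) n → var s n) → ∀ S → 𝒰 s S → Valid S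
  theory-valid vars S@(Γ ⇒ Δ) m p is =
    ↓⇒⟦⟧ ⌊ Δ ⌋ (over-⌊⌋ Δ (λ n o → vars n (S , m , inj₂ o)))
      (↓-mono (sequent⇒≤ (hyp m)) (⊩⇒↓ Γ (λ n o → vars n (S , m , inj₁ o)) is))

  -- The theory 𝒰 r is sound for the amalgam, and the latter is conservative over 𝒰 s.
  transfer : ∀ r s → (∀ n → V (𝒰 r) n → var r n) →
             (∀ {x y} → Shared x → Shared y → ∀ t → 𝒰 t ⊢ x ≤ y → 𝒰 s ⊢ x ≤ y) →
             ∀ S → (∀ n → OccS n S → var s n) → Deriv C (𝒰 r) S → Deriv C (𝒰 s) S
  transfer r s vars sub (Γ ⇒ Δ) over d =
    ≤⇒sequent Γ Δ (↓-conservative sub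
      (⟦⟧⇒↓ ⌊ Δ ⌋ (over-⌊⌋ Δ (λ n → over n ∘ inj₂))
        (sound (theory-valid vars) d _ (lower-⊩ Γ (λ n → over n ∘ inj₁)))))

-- The interpolant

module _ (C : Choice) (𝒮 : SeqSet C) (S : SeqC C) where

  open Calculus C

  SharedConsequence : SeqSet C
  SharedConsequence X = (∀ n → OccS n X → V 𝒮 n × OccS n S) × Deriv C 𝒮 X

  theory : Side → SeqSet C
  theory true  = 𝒮
  theory false = SharedConsequence

  variables : Side → ℕ → Set
  variables true  n = V 𝒮 n
  variables false n = OccS n S

  -- An inequality between shared formulas that follows from `𝒮` is itself a member of
  -- `SharedConsequence`. This is the hypothesis that conservativity requires.
  include : ∀ {x y : F} → Amalgam.Shared C theory variables x → Amalgam.Shared C theory variables y →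
            ∀ t → theory t ⊢ x ≤ y → SharedConsequence ⊢ x ≤ y
  include f g false d = d
  include {x} {y} f g true d = hyp ((λ n o → occ true n o , occ false n o) , d)
    where
    occ : ∀ s n → OccS n ((x ∷ []) ⇒ just y) → variables s n
    occ s n (inj₁ (here o)) = f s n o
    occ s n (inj₂ (just o)) = g s n o

theorem6p7 : (C : Choice) → DeductiveInterpolation C
theorem6p7 C 𝒮 S d =
  SharedConsequence C 𝒮 S ,
  (λ n (X , (vars , _) , o) → vars n o) ,
  Amalgam.transfer C (theory C 𝒮 S) (variables C 𝒮 S) true false
    (λ _ v → v) (include C 𝒮 S) S (λ _ o → o) d ,
  (λ X → proj₂)
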